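{- Let $n\ge 2$, let $\mathbf A=(A,q,\mathsf e_1,\dots,\mathsf e_n)$ be an $n\mathrm{BA}$ and let $i\in\{1,\dots,n\}$. Then the skew $i$-reduct $S_i(\mathbf A)=(A,\land_i,\overline\vee_i,\setminus_i,\mathsf e_i)$ is a right-handed skew Boolean algebra with bottom element $\mathsf e_i$, and the elements $\mathsf e_1,\dots,\mathsf e_{i-1},\mathsf e_{i+1},\dots,\mathsf e_n$ are maximal elements (with respect to its natural partial order).
   Context: Let $n\ge 2$. An $n\mathrm{BA}$ (Boolean-like algebra of dimension $n$) is an algebra $\mathbf A=(A,q,\mathsf e_1,\dots,\mathsf e_n)$ with $q$ of arity $n+1$ and constants $\mathsf e_1,\dots,\mathsf e_n$ satisfying the identities (B0) $q(\mathsf e_i,x^1,\dots,x^n)=x^i$ for $i=1,\dots,n$; (B1) $q(y,x,\dots,x)=x$; (B2) $q(y,q(y,x^{11},\dots,x^{1n}),\dots,q(y,x^{n1},\dots,x^{nn}))=q(y,x^{11},x^{22},\dots,x^{nn})$; (B3) $q(y,q(x^{10},\dots,x^{1n}),\dots,q(x^{n0},\dots,x^{nn}))=q(q(y,x^{10},\dots,x^{n0}),\dots,q(y,x^{1n},\dots,x^{nn}))$; (B4) $q(y,\mathsf e_1,\dots,\mathsf e_n)=y$. For $i\in\{1,\dots,n\}$ let $t_i(x,y,z)=q(x,w_1,\dots,w_n)$ with $w_i=z$ and $w_k=y$ for $k\ne i$. Define $x\land_i y=t_i(x,y,\mathsf e_i)$, $x\,\overline\vee_i\,y=t_i(x,x,y)$,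 $y\setminus_i x=t_i(x,\mathsf e_i,y)$. A skew lattice is an algebra $(A,\lor,\land)$ with $\lor,\land$ associative and idempotent, satisfying $x\lor(x\land y)=x=x\land(x\lor y)$ and $(y\land x)\lor x=x=(y\lor x)\land x$. A skew Boolean algebra is an algebra $(A,\lor,\land,\setminus,0)$ of type $(2,2,2,0)$ such that: $(A,\lor,\land)$ is a skew lattice satisfying $x\land y\land z\land x=x\land z\land y\land x$, $x\land(y\lor z)=(x\land y)\lor(x\land z)$, $(y\lor z)\land x=(y\land x)\lor(z\land x)$; $0\land x=0=x\land 0$; and $(x\land y\land x)\lor(x\setminus y)=x=(x\setminus y)\lor(x\land y\land x)$, $x\land y\land x\land(x\setminus y)=0=(x\setminus y)\land x\land y\land x$. It is right-handed if $a\land b\land a=b\land a$ for all $a,b$. Its natural partial order is $x\le y$ iff $x\land y=x=y\land x$. In $S_i(\mathbf A)$ the operation $\overline\vee_i$ plays the role of $\lor$, $\land_i$ of $\land$, $\setminus_i$ of $\setminus$, and $\mathsf e_i$ of $0$. -}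

module Defs where

open import Level using (Level; _⊔_; suc)
open import Data.Nat.Base using (ℕ)
open import Data.Fin.Base using (Fin)
open import Data.Vec.Functional using (Vector; replicate; updateAt)
open import Data.Product.Base using (_×_)
open import Function.Base using (const)
open import Relation.Binary.Core using (Rel)
open import Relation.Binary.Structures using (IsEquivalence)
open import Algebra.Core using (Op₂)
import Algebra.Definitions
import Algebra.Structures

-- As in the library's algebraic hierarchy, carriers are setoids: identities
-- hold up to _≈_ and every operation is required to respect _≈_.

-- The operation q of arity n + 1 takes its last n arguments as a vector, and
-- e i is the i-th constant.  In B2 and B3, xs k is the k-th row of the matrix.
record BooleanLikeAlgebra (c ℓ : Level) (n : ℕ) : Set (suc (c ⊔ ℓ)) where
  infix 4 _≈_
  field
    Carrier       : Set c
    _≈_           : Rel Carrier ℓ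
    q             : Carrier → Vector Carrier n → Carrier
    e             : Vector Carrier n
    isEquivalence : IsEquivalence _≈_
    q-cong        : ∀ {y y′ : Carrier} {x x′ : Vector Carrier n} →
                    y ≈ y′ → (∀ k → x k ≈ x′ k) → q y x ≈ q y′ x′
    B0 : ∀ (i : Fin n) (x : Vector Carrier n) → q (e i) x ≈ x i
    B1 : ∀ (y x : Carrier) → q y (replicate n x) ≈ x
    B2 : ∀ (y : Carrier) (xs : Vector (Vector Carrier n) n) →
         q y (λ k → q y (xs k)) ≈ q y (λ k → xs k k)
    -- x⁰ is the column of the entries with second index 0.
    B3 : ∀ (y : Carrier) (x⁰ : Vector Carrier n) (xs : Vector (Vector Carrier n) n) →
         q y (λ k → q (x⁰ k) (xs k)) ≈ q (q y x⁰) (λ j → q y (λ k → xs k j))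
    B4 : ∀ (y : Carrier) → q y e ≈ y

  t : Fin n → Carrier → Carrier → Carrier → Carrier
  t i x y z = q x (updateAt (replicate n y) i (const z))

record RawSkewBooleanAlgebra (c ℓ : Level) : Set (suc (c ⊔ ℓ)) where
  infix  4 _≈_ _≤_
  infixl 6 _∨_
  infixl 7 _∧_
  infixl 8 _∖_
  field
    Carrier : Set c
    _≈_     : Rel Carrier ℓ
    _∨_     : Op₂ Carrier
    _∧_     : Op₂ Carrier
    _∖_     : Op₂ Carrier
    0#      : Carrier

  _≤_ : Rel Carrier ℓ
  x ≤ y = (x ∧ y ≈ x) × (y ∧ x ≈ x)

module _ {a ℓ : Level} {A : Set a} (_≈_ : Rel A ℓ) where

  open Algebra.Definitions _≈_
  open Algebra.Structures _≈_

  record IsSkewLattice (_∨_ _∧_ : Op₂ A) : Set (a ⊔ ℓ) where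
    field
      ∨-isBand    : IsBand _∨_
      ∧-isBand    : IsBand _∧_
      ∨-absorbs-∧ : _∨_ Absorbs _∧_
      ∧-absorbs-∨ : _∧_ Absorbs _∨_
      ∧-∨-absorbʳ : ∀ x y → ((y ∧ x) ∨ x) ≈ x
      ∨-∧-absorbʳ : ∀ x y → ((y ∨ x) ∧ x) ≈ x

module _ {c ℓ : Level} (S : RawSkewBooleanAlgebra c ℓ) where

  open RawSkewBooleanAlgebra S
  open Algebra.Definitions _≈_

  record IsSkewBooleanAlgebra : Set (c ⊔ ℓ) where
    field
      isSkewLattice   : IsSkewLattice _≈_ _∨_ _∧_
      ∖-cong          : Congruent₂ _∖_
      ∧-normal        : ∀ x y z → x ∧ y ∧ z ∧ x ≈ x ∧ z ∧ y ∧ x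
      ∧-distrib-∨     : _∧_ DistributesOver _∨_
      ∧-zero          : Zero 0# _∧_
      ∖-complementˡ-∨ : ∀ x y → (x ∧ y ∧ x) ∨ (x ∖ y) ≈ x
      ∖-complementʳ-∨ : ∀ x y → (x ∖ y) ∨ (x ∧ y ∧ x) ≈ x
      ∖-complementˡ-∧ : ∀ x y → x ∧ y ∧ x ∧ (x ∖ y) ≈ 0#
      ∖-complementʳ-∧ : ∀ x y → (x ∖ y) ∧ x ∧ y ∧ x ≈ 0#

  RightHanded : Set (c ⊔ ℓ)
  RightHanded = ∀ a b → a ∧ b ∧ a ≈ b ∧ a

  Maximal : Carrier → Set (c ⊔ ℓ)
  Maximal m = ∀ x → m ≤ x → x ≈ m

-- Note the order of arguments of _∖_: the subtracted element is the one that
-- becomes the first argument of t.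
skewReduct : ∀ {c ℓ : Level} {n : ℕ} →
             BooleanLikeAlgebra c ℓ n → Fin n → RawSkewBooleanAlgebra c ℓ
skewReduct A i = record
  { Carrier = Carrier
  ; _≈_     = _≈_
  ; _∨_     = λ x y → t i x x y
  ; _∧_     = λ x y → t i x y (e i)
  ; _∖_     = λ y x → t i x (e i) y
  ; 0#      = e i
  }
  where open BooleanLikeAlgebra A

{-# OPTIONS --safe #-}

-- Every identity of the reduct involves only the ternary operation t = t_i and
-- the constant e_i.  For a fixed x, the kernels of t(x, -, e_i) and
-- t(x, e_i, -) are congruences with trivial intersection; modulo the first,
-- t(x, a, b) = a, and modulo the second, x = e_i.  Hence an identity holds as
-- soon as it holds whenever each of its variables either is e_i or selects the
-- first branch of t, and this is a finite check, carried out by evaluation.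
module Submission where

open import Defs
open import Level using (Level; _⊔_)
open import Data.Bool.Base using (Bool; true; false; if_then_else_)
open import Data.Nat.Base using (ℕ; suc; _≤_)
open import Data.Fin.Base using (Fin; zero; suc)
import Data.Fin.Properties as Fin
open import Data.Fin.Subset.Properties using (anySubset?)
open import Data.Maybe.Base using (Maybe; just; nothing)
import Data.Maybe.Properties as Maybe
open import Data.Product.Base using (_×_; _,_)
open import Data.Vec.Base using (Vec; []; _∷_; lookup)
open import Data.Vec.Functional using (Vector; replicate; updateAt)
open import Data.Vec.Functional.Properties using (updateAt-updates; updateAt-minimal)
open import Data.Vec.Relation.Binary.Pointwise.Inductive as Pointwise using (Pointwise; []; _∷_)
open import Function.Base using (_on_; _∘_; _$_; const)
import Relation.Binary.Construct.On as On
open import Relation.Binary.Core using (Rel; _⇒_)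
open import Relation.Binary.Bundles using (Setoid)
open import Relation.Binary.Definitions using (Minimum)
open import Relation.Binary.PropositionalEquality as ≡ using (_≡_; _≢_)
import Relation.Binary.Reasoning.Setoid as SetoidReasoning
open import Relation.Binary.Structures using (IsEquivalence)
open import Relation.Nullary.Decidable using (Dec; True; toWitness; ¬?; decidable-stable)

private variable
  a ℓ : Level
  m n : ℕ

-- Algebras with a conditional operation and their congruences.

module _ {A : Set a} (t : A → A → A → A) (0# : A) where

  -- Passing to a quotient replaces only `_≈_`. The carrier, `t` and `0#` stay fixed, so the two
  -- elements compared are the same in every quotient.
  record IsConditional (_≈_ : Rel A ℓ) : Set (a ⊔ ℓ) where
    field
      isEquivalence : IsEquivalence _≈_
      t-cong        : ∀ {x x′ y y′ z z′} → x ≈ x′ → y ≈ y′ → z ≈ z′ → t x y z ≈ t x′ y′ z′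
      t-zero        : ∀ y z → t 0# y z ≈ z
      t-const       : ∀ x y → t x y y ≈ y
      t-diagonal    : ∀ x y y′ z z′ → t x (t x y y′) (t x z z′) ≈ t x y z′
      t-interchange : ∀ x y₁ y₂ y₃ z₁ z₂ z₃ →
                      t x (t y₁ y₂ y₃) (t z₁ z₂ z₃) ≈ t (t x y₁ z₁) (t x y₂ z₂) (t x y₃ z₃)
      t-self        : ∀ x → t x x 0# ≈ x

    open IsEquivalence isEquivalence public

    setoid : Setoid a ℓ
    setoid = record { isEquivalence = isEquivalence }

  -- The name `nonzero` refers to the branch that `x` selects. It does not exclude `x ≈ 0#`: in a
  -- trivial quotient both cases hold.
  data Decided (_≈_ : Rel A ℓ) : Bool → A → Set (a ⊔ ℓ) where
    nonzero : ∀ {x} → (∀ y z → t x y z ≈ y) → Decided _≈_ true x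
    isZero  : ∀ {x} → x ≈ 0# → Decided _≈_ false x

  Decided-mono : {_≈_ _≈′_ : Rel A ℓ} → _≈_ ⇒ _≈′_ →
                 ∀ {b x} → Decided _≈_ b x → Decided _≈′_ b x
  Decided-mono ≈⇒≈′ (nonzero x-left) = nonzero λ y z → ≈⇒≈′ (x-left y z)
  Decided-mono ≈⇒≈′ (isZero x≈0)     = isZero (≈⇒≈′ x≈0)

  module _ {_≈_ : Rel A ℓ} (isConditional : IsConditional _≈_) where

    open IsConditional isConditional
    open SetoidReasoning setoid

    -- Every identity survives in the coarser relation by `h-cong`; `h-homo` is what makes that
    -- relation compatible with `t`.
    kernel : (h : A → A) → (∀ {x y} → x ≈ y → h x ≈ h y) →
             (∀ x y z → h (t x y z) ≈ t (h x) (h y) (h z)) →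
             IsConditional (_≈_ on h)
    kernel h h-cong h-homo = record
      { isEquivalence = On.isEquivalence h isEquivalence
      ; t-cong        = λ x≈x′ y≈y′ z≈z′ →
          trans (h-homo _ _ _) (trans (t-cong x≈x′ y≈y′ z≈z′) (sym (h-homo _ _ _)))
      ; t-zero        = λ y z → h-cong (t-zero y z)
      ; t-const       = λ x y → h-cong (t-const x y)
      ; t-diagonal    = λ x y y′ z z′ → h-cong (t-diagonal x y y′ z z′)
      ; t-interchange = λ x y₁ y₂ y₃ z₁ z₂ z₃ → h-cong (t-interchange x y₁ y₂ y₃ z₁ z₂ z₃)
      ; t-self        = λ x → h-cong (t-self x)
      }

    module _ (x : A) where

      onNonzero onZero : A → A
      onNonzero y = t x y 0#
      onZero    y = t x 0# y

      onNonzero-cong : ∀ {y z} → y ≈ z → onNonzero y ≈ onNonzero z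
      onNonzero-cong y≈z = t-cong refl y≈z refl

      onZero-cong : ∀ {y z} → y ≈ z → onZero y ≈ onZero z
      onZero-cong y≈z = t-cong refl refl y≈z

      onNonzero-isConditional : IsConditional (_≈_ on onNonzero)
      onNonzero-isConditional = kernel onNonzero onNonzero-cong λ y₁ y₂ y₃ →
        -- Writing the fixed branch `0#` as `t 0# 0# 0#` gives both branches the shape that
        -- `t-interchange` expects.
        trans (t-cong refl refl (sym (t-const 0# 0#))) (t-interchange x y₁ y₂ y₃ 0# 0# 0#)

      onZero-isConditional : IsConditional (_≈_ on onZero)
      onZero-isConditional = kernel onZero onZero-cong λ z₁ z₂ z₃ →
        trans (t-cong refl (sym (t-const 0# 0#)) refl) (t-interchange x 0# 0# 0# z₁ z₂ z₃)

      onNonzero-decides : Decided (_≈_ on onNonzero) true x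
      onNonzero-decides = nonzero λ y z →
        -- Here `0#` becomes `t x 0# 0#`, so that `t-diagonal` removes the inner test of `x`.
        trans (t-cong refl refl (sym (t-const x 0#))) (t-diagonal x y z 0# 0#)

      onZero-decides : Decided (_≈_ on onZero) false x
      onZero-decides = isZero (begin
        -- The goal is `onZero x ≈ onZero 0#`. By `t-self`, `x` is a conditional on itself with
        -- second branch `0#`, and `t-diagonal` keeps that branch.
        t x 0# x                      ≈⟨ t-cong refl (t-const x 0#) (t-self x) ⟨
        t x (t x 0# 0#) (t x x 0#)    ≈⟨ t-diagonal x 0# 0# x 0# ⟩
        t x 0# 0#                     ∎)

      -- An element is recovered from its two images by gluing them along `x`, with `t-diagonal` and
      -- then `t-const`.
      separated : ∀ {y z} → onNonzero y ≈ onNonzero z → onZero y ≈ onZero z → y ≈ z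
      separated {y} {z} nonzero-≈ zero-≈ = begin
        y                              ≈⟨ glue y ⟨
        t x (onNonzero y) (onZero y)   ≈⟨ t-cong refl nonzero-≈ zero-≈ ⟩
        t x (onNonzero z) (onZero z)   ≈⟨ glue z ⟩
        z                              ∎
        where
        glue : ∀ w → t x (onNonzero w) (onZero w) ≈ w
        glue w = trans (t-diagonal x w 0# 0# w) (t-const x w)

  -- Each split coarsens the relation, so the goal ranges over all coarser conditional relations.
  -- The inclusion `_≈_ ⇒ _≈′_` carries a decision about `x` through the later splits.
  byCases : ∀ {_≈_ : Rel A ℓ} → IsConditional _≈_ → (ρ : Vec A m) → ∀ {y z} →
            (∀ (s : Vec Bool m) {_≈′_ : Rel A ℓ} → IsConditional _≈′_ → _≈_ ⇒ _≈′_ →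
             Pointwise (Decided _≈′_) s ρ → y ≈′ z) →
            y ≈ z
  byCases isC []      goal = goal [] isC (λ y≈z → y≈z) []
  byCases isC (x ∷ ρ) goal = separated isC x
    (byCases (onNonzero-isConditional isC x) ρ λ s isC′ ≈⇒≈′ dec →
      goal (true ∷ s) isC′ (λ y≈z → ≈⇒≈′ (onNonzero-cong isC x y≈z))
        (Decided-mono ≈⇒≈′ (onNonzero-decides isC x) ∷ dec))
    (byCases (onZero-isConditional isC x) ρ λ s isC′ ≈⇒≈′ dec →
      goal (false ∷ s) isC′ (λ y≈z → ≈⇒≈′ (onZero-cong isC x y≈z))
        (Decided-mono ≈⇒≈′ (onZero-decides isC x) ∷ dec))

-- Deciding identities by evaluation.

data Term (m : ℕ) : Set where
  var  : Fin m → Term m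
  𝟘    : Term m
  cond : Term m → Term m → Term m → Term m

-- The value of a term under an assignment of zero (false) or nonzero (true) to
-- its variables: nothing stands for zero, just j for the nonzero variable j.
eval : Vec Bool m → Term m → Maybe (Fin m)
eval s (var j)      = if lookup s j then just j else nothing
eval s 𝟘            = nothing
eval s (cond f g h) with eval s f
... | just _  = eval s g
... | nothing = eval s h

_≟_under_ : (f g : Term m) (s : Vec Bool m) → Dec (eval s f ≡ eval s g)
f ≟ g under s = Maybe.≡-dec Fin._≟_ (eval s f) (eval s g)

-- Subsets of the variables are exactly the assignments, so the search is exhaustive. For concrete
-- terms `True` computes to the unit type, and the implicit `valid` is filled in automatically.
Valid : Term m → Term m → Set
Valid f g = True (¬? (anySubset? λ s → ¬? (f ≟ g under s)))

module _ {A : Set a} (t : A → A → A → A) (0# : A) where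

  ⟦_⟧ : Term m → Vec A m → A
  ⟦ var j ⟧      ρ = lookup ρ j
  ⟦ 𝟘 ⟧          ρ = 0#
  ⟦ cond f g h ⟧ ρ = t (⟦ f ⟧ ρ) (⟦ g ⟧ ρ) (⟦ h ⟧ ρ)

  -- The constructor `nonzero` records two facts because a subterm may serve as a result or as the
  -- condition of a `cond`.
  data HasValue (_≈_ : Rel A ℓ) (ρ : Vec A m) (x : A) : Maybe (Fin m) → Set (a ⊔ ℓ) where
    nonzero : ∀ {j} → x ≈ lookup ρ j → (∀ y z → t x y z ≈ y) → HasValue _≈_ ρ x (just j)
    isZero  : x ≈ 0# → HasValue _≈_ ρ x nothing

  module _ {_≈_ : Rel A ℓ} (isConditional : IsConditional t 0# _≈_) where

    open IsConditional isConditional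

    module _ {ρ : Vec A m} where

      HasValue-resp : ∀ {x y v} → x ≈ y → HasValue _≈_ ρ y v → HasValue _≈_ ρ x v
      HasValue-resp x≈y (nonzero y≈ρⱼ y-left) = nonzero (trans x≈y y≈ρⱼ)
        λ z w → trans (t-cong x≈y refl refl) (y-left z w)
      HasValue-resp x≈y (isZero y≈0)          = isZero (trans x≈y y≈0)

      HasValue-unique : ∀ {x y v} → HasValue _≈_ ρ x v → HasValue _≈_ ρ y v → x ≈ y
      HasValue-unique (nonzero x≈ρⱼ _) (nonzero y≈ρⱼ _) = trans x≈ρⱼ (sym y≈ρⱼ)
      HasValue-unique (isZero x≈0)     (isZero y≈0)     = trans x≈0 (sym y≈0)

      -- By induction on the term. A condition with a nonzero value selects the first branch; one
      -- equal to `0#` selects the second by `t-zero`. This is the case split of `eval`.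
      eval-sound : ∀ {s} → Pointwise (Decided t 0# _≈_) s ρ →
                   ∀ f → HasValue _≈_ ρ (⟦ f ⟧ ρ) (eval s f)
      eval-sound {s} dec (var j) with lookup s j | Pointwise.lookup dec j
      ... | _ | nonzero ρⱼ-left = nonzero refl ρⱼ-left
      ... | _ | isZero ρⱼ≈0     = isZero ρⱼ≈0
      eval-sound dec 𝟘 = isZero refl
      eval-sound {s} dec (cond f g h) with eval s f | eval-sound dec f
      ... | _ | nonzero _ f-left = HasValue-resp (f-left _ _) (eval-sound dec g)
      ... | _ | isZero f≈0       =
        HasValue-resp (trans (t-cong f≈0 refl refl) (t-zero _ _)) (eval-sound dec h)

  prove : ∀ {_≈_ : Rel A ℓ} → IsConditional t 0# _≈_ →
          (ρ : Vec A m) (f g : Term m) {valid : Valid f g} → ⟦ f ⟧ ρ ≈ ⟦ g ⟧ ρ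
  prove isConditional ρ f g {valid} = byCases t 0# isConditional ρ λ s isC′ _ dec →
    HasValue-unique isC′ (eval-sound isC′ dec f)
      (≡.subst (HasValue _ ρ _) (≡.sym (evals-agree s)) (eval-sound isC′ dec g))
    where
    evals-agree : ∀ s → eval s f ≡ eval s g
    -- `Valid` only denies a counterexample; decidability turns this into agreement at `s`.
    evals-agree s = decidable-stable (f ≟ g under s) λ f≢g → toWitness valid (s , f≢g)

-- Vectors that are constant away from one index.

choose : {B : Set a} → Fin n → B → B → Vector B n
choose i y z = updateAt (replicate _ y) i (const z)

module _ {B : Set a} where

  choose-const : (i k : Fin n) (y : B) → choose i y y k ≡ y
  choose-const zero    zero    y = ≡.refl
  choose-const zero    (suc k) y = ≡.refl
  choose-const (suc i) zero    y = ≡.refl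
  choose-const (suc i) (suc k) y = choose-const i k y

  choose-lookup : (i k : Fin n) (v : Vector B n) → choose i (v k) (v i) k ≡ v k
  choose-lookup zero    zero    v = ≡.refl
  choose-lookup zero    (suc k) v = ≡.refl
  choose-lookup (suc i) zero    v = ≡.refl
  choose-lookup (suc i) (suc k) v = choose-lookup i k (v ∘ suc)

  choose-nested : (i k : Fin n) (y y′ z z′ : B) →
                  choose i (choose i y y′ k) (choose i z z′ k) k ≡ choose i y z′ k
  choose-nested zero    zero    y y′ z z′ = ≡.refl
  choose-nested zero    (suc k) y y′ z z′ = ≡.refl
  choose-nested (suc i) zero    y y′ z z′ = ≡.refl
  choose-nested (suc i) (suc k) y y′ z z′ = choose-nested i k y y′ z z′

  choose-zipWith : ∀ {c d} {C : Set c} {D : Set d} (f : B → C → D) (i k : Fin n) {y z : B} {y′ z′ : C} →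
                   f (choose i y z k) (choose i y′ z′ k) ≡ choose i (f y y′) (f z z′) k
  choose-zipWith f zero    zero    = ≡.refl
  choose-zipWith f zero    (suc k) = ≡.refl
  choose-zipWith f (suc i) zero    = ≡.refl
  choose-zipWith f (suc i) (suc k) = choose-zipWith f i k

  choose-map : ∀ {c} {C : Set c} (f : B → C) (i k : Fin n) {y z : B} →
               f (choose i y z k) ≡ choose i (f y) (f z) k
  choose-map f i k {y} {z} = choose-zipWith (λ x _ → f x) i k {y} {z} {y} {z}

  choose-pres : (_≈_ : Rel B ℓ) (i k : Fin n) {y y′ z z′ : B} →
                y ≈ y′ → z ≈ z′ → choose i y z k ≈ choose i y′ z′ k
  choose-pres _≈_ zero    zero    y≈y′ z≈z′ = z≈z′
  choose-pres _≈_ zero    (suc k) y≈y′ z≈z′ = y≈y′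
  choose-pres _≈_ (suc i) zero    y≈y′ z≈z′ = y≈y′
  choose-pres _≈_ (suc i) (suc k) y≈y′ z≈z′ = choose-pres _≈_ i k y≈y′ z≈z′

-- The conditional structure of a Boolean-like algebra.

module _ {c ℓ : Level} {n : ℕ} (A : BooleanLikeAlgebra c ℓ n) (i : Fin n) where

  open BooleanLikeAlgebra A
  open IsEquivalence isEquivalence

  private
    setoid : Setoid c ℓ
    setoid = record { isEquivalence = isEquivalence }

  open SetoidReasoning setoid

  q-congʳ : ∀ {x} {v w : Vector Carrier n} → (∀ k → v k ≡ w k) → q x v ≈ q x w
  q-congʳ v≗w = q-cong refl (reflexive ∘ v≗w)

  t-isConditional : IsConditional (t i) (e i) _≈_
  t-isConditional = record
    { isEquivalence = isEquivalence
    ; t-cong        = λ x≈x′ y≈y′ z≈z′ →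
        q-cong x≈x′ λ k → choose-pres _≈_ i k y≈y′ z≈z′
    ; t-zero        = λ y z →
        trans (B0 i (choose i y z)) (reflexive (updateAt-updates i (replicate n y)))
    ; t-const       = λ x y → trans (q-congʳ λ k → choose-const i k y) (B1 x y)
    ; t-diagonal    = λ x y y′ z z′ →
        -- A `choose` of vectors is a matrix. The diagonal of this one has `z′` at `i` and `y`
        -- elsewhere.
        let rows = choose i (choose i y y′) (choose i z z′) in begin
        t i x (t i x y y′) (t i x z z′)  ≈⟨ q-congʳ (λ k → choose-map (q x) i k) ⟨
        q x (λ k → q x (rows k))         ≈⟨ B2 x rows ⟩
        q x (λ k → rows k k)             ≈⟨ q-congʳ (λ k → ≡.trans (choose-map (_$ k) i k) (choose-nested i k y y′ z z′)) ⟩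
        t i x y z′                       ∎
    ; t-interchange = λ x y₁ y₂ y₃ z₁ z₂ z₃ →
        -- `B3` exchanges rows and columns. Column `j` is again a `choose`, of the `j`-th entries of
        -- the two kinds of row.
        let rows = choose i (choose i y₂ y₃) (choose i z₂ z₃) in begin
        t i x (t i y₁ y₂ y₃) (t i z₁ z₂ z₃)                 ≈⟨ q-congʳ (λ k → choose-zipWith q i k) ⟨
        q x (λ k → q (choose i y₁ z₁ k) (rows k))           ≈⟨ B3 x (choose i y₁ z₁) rows ⟩
        q (t i x y₁ z₁) (λ j → q x (λ k → rows k j))        ≈⟨ q-cong refl (λ j → trans
                                                                  (q-congʳ λ k → choose-map (_$ j) i k)
                                                                  (reflexive (choose-zipWith (t i x) i j))) ⟩
        t i (t i x y₁ z₁) (t i x y₂ z₂) (t i x y₃ z₃)       ∎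
    ; t-self        = λ x →
        -- Row `i` is constantly `e i`, and every other row is `e`. Applying `q x` to the rows gives
        -- `e i` by `B1` and `x` by `B4`, while the diagonal is `e` itself.
        let rows = choose i e (replicate n (e i)) in begin
        t i x x (e i)             ≈⟨ q-cong refl (λ k → trans
                                       (reflexive (choose-map (q x) i k))
                                       (choose-pres _≈_ i k (B4 x) (B1 x (e i)))) ⟨
        q x (λ k → q x (rows k))  ≈⟨ B2 x rows ⟩
        q x (λ k → rows k k)      ≈⟨ q-congʳ (λ k → ≡.trans (choose-map (_$ k) i k) (choose-lookup i k e)) ⟩
        q x e                     ≈⟨ B4 x ⟩
        x                         ∎
    }

  open IsConditional t-isConditional using (t-cong)

  -- The laws of the skew reduct.

  private
    infixl 6 _∨_
    infixl 7 _∧_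
    infixl 8 _∖_

    -- These copy the operations of `skewReduct`, so interpreted terms unfold to the laws as stated.
    _∨_ _∧_ _∖_ : Term m → Term m → Term m
    f ∨ g = cond f f g
    f ∧ g = cond f g 𝟘
    g ∖ f = cond f 𝟘 g

    X : Term (suc m)
    X = var zero

    Y : Term (suc (suc m))
    Y = var (suc zero)

    Z : Term (suc (suc (suc m)))
    Z = var (suc (suc zero))

    by : (ρ : Vec Carrier m) (f g : Term m) {valid : Valid f g} →
         ⟦_⟧ (t i) (e i) f ρ ≈ ⟦_⟧ (t i) (e i) g ρ
    by = prove (t i) (e i) t-isConditional

  skewReduct-isSkewLattice : let module S = RawSkewBooleanAlgebra (skewReduct A i) in
                             IsSkewLattice _≈_ S._∨_ S._∧_
  skewReduct-isSkewLattice = record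
    { ∨-isBand = record
      { isSemigroup = record
        { isMagma = record
          { isEquivalence = isEquivalence
          ; ∙-cong        = λ x≈x′ y≈y′ → t-cong x≈x′ x≈x′ y≈y′
          }
        ; assoc = λ x y z → by (x ∷ y ∷ z ∷ []) (X ∨ Y ∨ Z) (X ∨ (Y ∨ Z))
        }
      ; idem = λ x → by (x ∷ []) (X ∨ X) X
      }
    ; ∧-isBand = record
      { isSemigroup = record
        { isMagma = record
          { isEquivalence = isEquivalence
          ; ∙-cong        = λ x≈x′ y≈y′ → t-cong x≈x′ y≈y′ refl
          }
        ; assoc = λ x y z → by (x ∷ y ∷ z ∷ []) (X ∧ Y ∧ Z) (X ∧ (Y ∧ Z))
        }
      ; idem = λ x → by (x ∷ []) (X ∧ X) X
      }
    ; ∨-absorbs-∧ = λ x y → by (x ∷ y ∷ []) (X ∨ X ∧ Y) X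
    ; ∧-absorbs-∨ = λ x y → by (x ∷ y ∷ []) (X ∧ (X ∨ Y)) X
    ; ∧-∨-absorbʳ = λ x y → by (x ∷ y ∷ []) (Y ∧ X ∨ X) X
    ; ∨-∧-absorbʳ = λ x y → by (x ∷ y ∷ []) ((Y ∨ X) ∧ X) X
    }

  skewReduct-isSkewBooleanAlgebra : IsSkewBooleanAlgebra (skewReduct A i)
  skewReduct-isSkewBooleanAlgebra = record
    { isSkewLattice   = skewReduct-isSkewLattice
    ; ∖-cong          = λ y≈y′ x≈x′ → t-cong x≈x′ refl y≈y′
    ; ∧-normal        = λ x y z → by (x ∷ y ∷ z ∷ []) (X ∧ Y ∧ Z ∧ X) (X ∧ Z ∧ Y ∧ X)
    ; ∧-distrib-∨     = (λ x y z → by (x ∷ y ∷ z ∷ []) (X ∧ (Y ∨ Z)) (X ∧ Y ∨ X ∧ Z))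
                      , (λ x y z → by (x ∷ y ∷ z ∷ []) ((Y ∨ Z) ∧ X) (Y ∧ X ∨ Z ∧ X))
    ; ∧-zero          = (λ x → by (x ∷ []) (𝟘 ∧ X) 𝟘)
                      , (λ x → by (x ∷ []) (X ∧ 𝟘) 𝟘)
    ; ∖-complementˡ-∨ = λ x y → by (x ∷ y ∷ []) (X ∧ Y ∧ X ∨ X ∖ Y) X
    ; ∖-complementʳ-∨ = λ x y → by (x ∷ y ∷ []) (X ∖ Y ∨ X ∧ Y ∧ X) X
    ; ∖-complementˡ-∧ = λ x y → by (x ∷ y ∷ []) (X ∧ Y ∧ X ∧ X ∖ Y) 𝟘
    ; ∖-complementʳ-∧ = λ x y → by (x ∷ y ∷ []) (X ∖ Y ∧ X ∧ Y ∧ X) 𝟘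
    }

  skewReduct-rightHanded : RightHanded (skewReduct A i)
  skewReduct-rightHanded x y = by (x ∷ y ∷ []) (X ∧ Y ∧ X) (Y ∧ X)

  skewReduct-minimum : Minimum (RawSkewBooleanAlgebra._≤_ (skewReduct A i)) (e i)
  skewReduct-minimum x = by (x ∷ []) (𝟘 ∧ X) 𝟘 , by (x ∷ []) (X ∧ 𝟘) 𝟘

  -- By `B0`, `e k` projects to entry `k`; since `k ≢ i`, it selects the first branch, so `e k ∧ x`
  -- is `x`. The order makes the same meet equal to `e k`.
  skewReduct-maximal : ∀ k → k ≢ i → Maximal (skewReduct A i) (e k)
  skewReduct-maximal k k≢i x (eₖ∧x≈eₖ , _) = begin
    x                   ≡⟨ updateAt-minimal k i (replicate n x) k≢i ⟨
    choose i x (e i) k  ≈⟨ B0 k (choose i x (e i)) ⟨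
    t i (e k) x (e i)   ≈⟨ eₖ∧x≈eₖ ⟩
    e k                 ∎

corollary4p5 : ∀ {c ℓ : Level} (n : ℕ) → 2 ≤ n →
    (A : BooleanLikeAlgebra c ℓ n) (i : Fin n) →
    IsSkewBooleanAlgebra (skewReduct A i)
    × RightHanded (skewReduct A i)
    × Minimum (RawSkewBooleanAlgebra._≤_ (skewReduct A i)) (BooleanLikeAlgebra.e A i)
    × (∀ (k : Fin n) → k ≢ i → Maximal (skewReduct A i) (BooleanLikeAlgebra.e A k))
corollary4p5 n _ A i =
    skewReduct-isSkewBooleanAlgebra A i
  , skewReduct-rightHanded A i
  , skewReduct-minimum A i
  , skewReduct-maximal A i
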